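{- Let $P$ (messages), $K$ (keys) and $C$ (ciphertexts) be finite sets. Let $E \subseteq (P \times K) \times C$ be a relation (encryption) and let $(D_c)_{c \in C}$ be a family of relations $D_c \subseteq K \times P$ (decryption, controlled by the public ciphertext $c$). Suppose the following correctness condition holds: for all $p, p' \in P$ and all $c \in C$, $$\big(\exists k \in K:\ ((p,k),c) \in E \text{ and } (k,p') \in D_c\big) \iff p' = p.$$ Suppose moreover that $E$ satisfies the security property: for every $p \in P$, $\{c \in C : \exists k \in K,\ ((p,k),c) \in E\} = C$. If $E$ is invertible as a relation (i.e. $E$ is the graph of a bijection $P \times K \to C$), then $P$ has at most one element.
   Context: This is the concrete form, in the bicategory of matrices of relations ($\mathbf{2Rel}$), of a classical encrypted communication protocol using a one-time pad: the key is generated nondeterministically as the relation $\{(k,k) : k \in K\}$ from the one-element set to $K \times K$ (both parties receive the same key); Alice encrypts her private message $p$ with her key copy via $E$ producing public ciphertext $c$; Bob applies $D_c$ to his key copy to obtain a private message. The correctness condition says that the whole protocol equals the process which produces an arbitrary (nondeterministically chosen) public ciphertext and delivers $p$ unchanged to Bob. The security property says that encrypting with one key copy and discarding the other copy is the same as discarding the message and producing an arbitrary ciphertext. Invertibility of a 2-cell here means invertibility of the relation under relational composition, which for relations between finite sets means it is the graph of a bijection.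
   Formalization: The set C of ciphertexts is additionally assumed nonempty; without this the claim fails, for instance when K and C are empty, E is the empty relation and P has two elements. -}

module Defs where

open import Level using (Level; suc; _⊔_)
open import Data.Fin using (Fin)
open import Data.Product using (_×_; _,_; ∃; ∃-syntax)
open import Function.Bundles using (_⇔_; _↔_)
open import Relation.Binary.Core using (REL)
import Relation.Binary.Core as Rel
-- The library's composition operator is U+037E, not an ASCII semicolon.
open import Relation.Binary.Construct.Composition using () renaming (_;_ to _⨾_)
open import Relation.Binary.PropositionalEquality using (_≡_)
open import Relation.Unary using (_≐_; U)

private
  variable
    a b p k c e d : Level

Finite : Set a → Set a
Finite A = ∃[ n ] A ↔ Fin n

-- Two-sided inverse for relational composition, written in diagrammatic
-- order.  This forces R to be the graph of a bijection; the converse of such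
-- a graph lives at the level of R, so nothing is lost by fixing that level
-- for the inverse.
Invertible : {A : Set a} {B : Set b} → REL A B e → Set (a ⊔ b ⊔ suc e)
Invertible {e = e} {A = A} {B = B} R =
  ∃ λ (S : REL B A e) → ((R ⨾ S) Rel.⇔ _≡_) × ((S ⨾ R) Rel.⇔ _≡_)

module _ {P : Set p} {K : Set k} {C : Set c} where

  Correct : REL (P × K) C e → (C → REL K P d) → Set (p ⊔ k ⊔ c ⊔ e ⊔ d)
  Correct E D = ∀ (m m′ : P) (x : C) →
    (∃[ y ] E (m , y) x × D x y m′) ⇔ (m′ ≡ m)

  Secure : REL (P × K) C e → Set (p ⊔ k ⊔ c ⊔ e)
  Secure E = ∀ (m : P) → (λ x → ∃[ y ] E (m , y) x) ≐ U

{-# OPTIONS --safe #-}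
-- By security every message can be encrypted to any given ciphertext, while
-- an invertible E is injective, so a ciphertext determines its message.
module Submission where

open import Defs
open import Level using (Level)
open import Data.Product using (_×_; _,_; proj₁; proj₂)
open import Relation.Binary.Core using (REL)
open import Relation.Binary.PropositionalEquality using (_≡_; refl; sym; trans; cong)
open import Relation.Nullary using (Irrelevant)

-- The diagonal lies in `S ⨾ R`, so `S` sends `y` to some `z`; as `R ⨾ S` lies in the diagonal, both
-- `x` and `x′` equal that `z`.
invertible⇒injective : ∀ {a b e} {A : Set a} {B : Set b} {R : REL A B e} →
  Invertible R → ∀ {x x′ y} → R x y → R x′ y → x ≡ x′
invertible⇒injective (_ , (R⨾S⇒≡ , _) , (_ , ≡⇒S⨾R)) Rxy Rx′y =
  let _ , Syz , _ = ≡⇒S⨾R refl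
  in trans (R⨾S⇒≡ (_ , Rxy , Syz)) (sym (R⨾S⇒≡ (_ , Rx′y , Syz)))

-- A ciphertext must be given: if `C` and `K` are empty, the conditions hold for every `P`.
theorem5 : ∀ {p k c e d : Level} {P : Set p} {K : Set k} {C : Set c} →
    Finite P → Finite K → Finite C → C →
    (E : REL (P × K) C e) (D : C → REL K P d) →
    Correct E D → Secure E → Invertible E →
    Irrelevant P
theorem5 _ _ _ x E D _ secure invertible m m′ =
  -- The final `_` is the trivial membership in `U`. The keys for `m` and `m′` are chosen
  -- independently.
  let _ , Emx  = proj₂ (secure m) {x} _
      _ , Em′x = proj₂ (secure m′) {x} _
  in cong proj₁ (invertible⇒injective invertible Emx Em′x)
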